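{- Let $U$ be a countably infinite universe, $\mathcal{C}=(L_1,L_2,\ldots)$ a countably infinite collection of languages over $U$, and let $m^\star_n(L_j)$ be computed by the Noisy Procedure in the context. Suppose that for every $t\in\mathbb{N}$ the set $\{(n',j): m^\star_{n'}(L_j)+1\le t\}$ is finite. Then there exists an algorithm that noisily non-uniformly generates from $\mathcal{C}$ with generation times forming a Pareto-optimal family.
   Context: A language is an infinite subset of $U$; a collection is a sequence of languages (repetitions allowed, entries distinguished by index). For a language $L$ and integer $n\ge0$, an enumeration of $L$ at noise level $n$ is a sequence $x_1,x_2,\ldots$ of elements of $U$ such that every $x\in L$ equals some $x_t$ and $\sum_{t\ge1}\mathbf{1}[x_t\notin L]\le n$. A generating algorithm at each time $t\ge1$ receives $x_1,\ldots,x_t$ and outputs $z_t\in U$; $S_t$ is the set of distinct strings among $x_1,\ldots,x_t$. For a set $T$, language $L$ and integer $a\ge0$, $T$ is $a$-contained in $L$ if $\sum_{x\in T}\mathbf{1}[x\notin L]\le a$. An algorithm noisily non-uniformly generates from $\mathcal{C}$ with (finite) generation times $t_n(L_i)$ if for all $n\ge0$, $i\ge1$ and every enumeration of $L_i$ at noise level $n$, $z_t\in L_i\setminus S_t$ whenever $|S_t|\ge t_n(L_i)$; for an algorithm $\mathcal{G}$, $t_{n,\mathcal{G}}(L_i)$ is the least such value ($\infty$ if none). A family $(t_n(L_i))_{n\ge0,i\ge1}$ is Pareto-optimal if every algorithm $\mathcal{G}$ that noisily non-uniformly generates from $\mathcal{C}$ and satisfies $t_{n,\mathcal{G}}(L_i)<t_n(L_i)$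 for some pair $(n,i)$ also satisfies $t_{n',\mathcal{G}}(L_j)>t_{n'}(L_j)$ for some other pair $(n',j)$. Diagonal order: pairs $(n,i)$ ordered as $(0,1),(1,1),(0,2),(2,1),(1,2),(0,3),\ldots$, i.e. for $n'=0,1,2,\ldots$ and $h=0,\ldots,n'$ the pair $(n'-h,h+1)$. Each pair $(a,b)$ has an entry $L_{a,b}$, a copy of $L_b$ labelled $(a,b)$. Noisy Procedure. Set $\mathcal{C}'_0=()$. For $l=1,2,\ldots$, let $(n,i)$ be the $l$-th pair; append $L_{n,i}$ to the end of $\mathcal{C}'_{l-1}$ to get $\mathcal{C}'_l=(L'_1,\ldots,L'_l)$, set $j=l$. Repeat: (A) let $T$ be a finite subset of $U$ of largest size for which there is a subcollection $\mathcal{D}$ of the entries $(L'_1,\ldots,L'_j)$ including $L'_j$, such that $T$ is $a$-contained in $L_b$ for every entry $L_{a,b}\in\mathcal{D}$ and $\bigcap_{L_{a,b}\in\mathcal{D}}L_b$ is finite; $m_{\mathrm{chk}}=|T|$ ($0$ if no such $\mathcal{D}$ exists). (B) If $j\le1$ or $m_{\mathrm{chk}}>m^\star_a(L_b)$ where $L'_{j-1}=L_{a,b}$, stop. (C) Otherwise swap positions $j-1$, $j$, set $j\leftarrow j-1$, return to (A). On stopping, set $m^\star_n(L_i)=m_{\mathrm{chk}}$. -}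

module Defs where

open import Axiom.ExcludedMiddle using (ExcludedMiddle)
open import Data.Bool.Base using (if_then_else_)
open import Data.List.Base using (List; []; _∷_; length; map; sum; applyUpTo; deduplicate)
open import Data.List.Membership.Propositional using (_∈_; _∉_)
open import Data.List.Relation.Binary.Sublist.Propositional using (_⊆_)
open import Data.List.Relation.Unary.All using (All)
open import Data.List.Relation.Unary.Unique.Propositional using (Unique)
open import Data.Nat.Base using (ℕ; zero; suc; _+_; _≤_; _<_)
open import Data.Nat.Properties using (_<?_; +-identityʳ; +-suc; suc-injective)
open import Data.Product.Base using (_×_; _,_; proj₁; proj₂; ∃; ∃-syntax)
open import Level using (0ℓ)
open import Relation.Binary.Construct.Add.Supremum.Strict _<_ using (_<⁺_)
open import Relation.Binary.PropositionalEquality using (_≡_; _≢_; refl; sym; trans)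
open import Relation.Nullary.Construct.Add.Supremum using (_⁺; [_]; ⊤⁺)
open import Relation.Nullary.Decidable.Core using (yes; no; does)
open import Relation.Nullary.Negation.Core using (¬_)
open import Relation.Unary using (Pred)

Finite : {A : Set} → Pred A 0ℓ → Set
Finite {A} P = ∃[ xs ] ((x : A) → P x → x ∈ xs)

Infinite : {A : Set} → Pred A 0ℓ → Set
Infinite P = ¬ Finite P

record Language (U : Set) : Set₁ where
  field
    string   : Pred U 0ℓ
    infinite : Infinite string

open Language public

-- A function of the input x₁, …, xₜ (t ≥ 1); its value at [] is never used.
Algorithm : Set → Set
Algorithm U = List U → U

-- Languages are indexed from 0, so (n , i) stands for the pair (n, i+1).
Pair : Set
Pair = ℕ × ℕ

next : Pair → Pair
next (suc n , i) = n , suc i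
next (zero  , i) = suc i , zero

-- pair l is the (l+1)-th pair in the diagonal order.
pair : ℕ → Pair
pair zero    = zero , zero
pair (suc l) = next (pair l)

triangle : ℕ → ℕ
triangle zero    = zero
triangle (suc k) = triangle k + suc k

position : ℕ → ℕ → ℕ
position n i = triangle (n + i) + i

pair-position : ∀ n i → pair (position n i) ≡ (n , i)
pair-position n i = go (n + i) i n refl
  where
  go : ∀ k i n → n + i ≡ k → pair (triangle k + i) ≡ (n , i)
  go zero    zero    zero    refl = refl
  go (suc k) zero    (suc n) eq
    rewrite +-identityʳ n | suc-injective eq
          | +-identityʳ (triangle k + suc k) | +-suc (triangle k) k
          | go k k zero refl = refl
  go k       (suc i) n       eq
    rewrite +-suc (triangle k) i
          | go k i (suc n) (trans (sym (+-suc n i)) eq) = refl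

module NoisyGeneration (em : ExcludedMiddle 0ℓ) {U : Set} (C : ℕ → Language U) where

  𝟙 : Set → ℕ
  𝟙 P = if does (em {P}) then 1 else 0

  -- A series of natural numbers is at most n iff all its partial sums are.
  Enumeration : Language U → ℕ → (ℕ → U) → Set
  Enumeration L n x =
      (∀ u → string L u → ∃[ t ] x t ≡ u)
    × (∀ N → sum (applyUpTo (λ t → 𝟙 (¬ string L (x t))) N) ≤ n)

  -- Sequences are indexed from 0, so this is x₁, …, xₜ.
  input : (ℕ → U) → ℕ → List U
  input x t = applyUpTo x t

  S : (ℕ → U) → ℕ → List U
  S x t = deduplicate (λ u v → em {u ≡ v}) (input x t)

  GeneratesAfter : Algorithm U → ℕ → ℕ → ℕ → Set
  GeneratesAfter G n i m =
    ∀ x → Enumeration (C i) n x →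
    ∀ t → 1 ≤ t → m ≤ length (S x t) →
    string (C i) (G (input x t)) × G (input x t) ∉ S x t

  GeneratesWithTimes : Algorithm U → (ℕ → ℕ → ℕ) → Set
  GeneratesWithTimes G τ = ∀ n i → GeneratesAfter G n i (τ n i)

  Generates : Algorithm U → Set
  Generates G = ∃[ τ ] GeneratesWithTimes G τ

  -- GenerationTime G n i m : the least generation time of G is m, where
  -- m = ⊤⁺ (infinity) if there is none.
  GenerationTime : Algorithm U → ℕ → ℕ → ℕ ⁺ → Set
  GenerationTime G n i [ m ] =
    GeneratesAfter G n i m × (∀ k → GeneratesAfter G n i k → m ≤ k)
  GenerationTime G n i ⊤⁺    = ∀ k → ¬ GeneratesAfter G n i k

  ParetoOptimal : (ℕ → ℕ → ℕ) → Set
  ParetoOptimal τ =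
    ∀ G → Generates G →
    ∀ n i → (∃[ m ] GenerationTime G n i m × m <⁺ [ τ n i ]) →
    ∃[ n′ ] ∃[ j ] (n′ , j) ≢ (n , i) ×
      (∃[ m ] GenerationTime G n′ j m × [ τ n′ j ] <⁺ m)

  -- T is a finite set, given by a duplicate-free list.
  Contained : ℕ → List U → Language U → Set
  Contained a T L = sum (map (λ u → 𝟙 (¬ string L u)) T) ≤ a

  Intersection : List Pair → Pred U 0ℓ
  Intersection D u = All (λ (_ , b) → string (C b) u) D

  -- Collections of entries are listed from last to first: in
  -- Candidate e es, the entry e is L'ⱼ and es is L'ⱼ₋₁, …, L'₁.
  Candidate : Pair → List Pair → List U → Set
  Candidate e es T =
    Unique T ×
    (∃[ D ] D ⊆ (e ∷ es) × e ∈ D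
          × All (λ (a , b) → Contained a T (C b)) D
          × Finite (Intersection D))

  LargestSize : Pair → List Pair → ℕ → Set
  LargestSize e es m =
      (∃[ T ] Candidate e es T × length T ≡ m)
    × (∀ T → Candidate e es T → length T ≤ m)

  -- If some D qualifies then T = ∅ is a candidate, and candidates are bounded
  -- since |T| ≤ |⋂ D| + Σ a over D; so the second case means that no D exists.
  mchk : Pair → List Pair → ℕ
  mchk e es with em {∃ (LargestSize e es)}
  ... | yes (m , _) = m
  ... | no  _       = 0

  -- An entry together with the value m⋆ it received.
  Entry : Set
  Entry = Pair × ℕ

  -- Moves e forward past the entries es (last to first); returns m⋆ of e and
  -- the resulting collection.
  insert : Pair → List Entry → ℕ × List Entry
  insert e [] = mchk e [] , (e , mchk e []) ∷ []
  insert e ((f , m) ∷ es) with m <? mchk e (f ∷ map proj₁ es)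
  ... | yes _ = mchk e (f ∷ map proj₁ es)
              , (e , mchk e (f ∷ map proj₁ es)) ∷ (f , m) ∷ es
  ... | no  _ = proj₁ (insert e es) , (f , m) ∷ proj₂ (insert e es)

  -- procedure l is C'ₗ, from last to first.
  procedure : ℕ → List Entry
  procedure zero    = []
  procedure (suc l) = proj₂ (insert (pair l) (procedure l))

  -- The value set in the round that appends (n , i); cf. pair-position.
  m⋆ : ℕ → ℕ → ℕ
  m⋆ n i = proj₁ (insert (n , i) (procedure (position n i)))

{-# OPTIONS --safe #-}

-- Along the list built by the procedure m⋆ is nondecreasing, and the value of an
-- entry bounds every finite T contained (up to the permitted noise) in the members
-- of some D made of that entry and earlier ones with ⋂ D finite.  Hence, given S_t,
-- the languages of all the pairs with m⋆ < |S_t| in which S_t is contained have an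
-- infinite intersection, and the algorithm outputs an element of it outside S_t.
--
-- Conversely, let T of size m⋆ n i and D attain the value of (n , i).  The other
-- members of D have smaller m⋆.  An adversary enumerating T first is consistent
-- with all of D, so an algorithm that is at most as slow on the others and faster
-- on (n , i) must output an element of ⋂ D outside T; adding it to T contradicts
-- maximality.
module Submission where

open import Defs
open import Axiom.ExcludedMiddle using (ExcludedMiddle)
open import Data.Bool.Base using (true; false)
open import Data.Empty using (⊥)
open import Data.List.Base using (List; []; _∷_; length; map; applyUpTo; deduplicate; filter)
open import Data.List.Membership.Propositional using (_∈_; _∉_)
open import Data.List.Membership.Propositional.Properties using (∈-filter⁺; ∈-filter⁻; ∈-map⁺; ∈-map⁻)
open import Data.List.Properties using (filter-all; filter-notAll; map-applyUpTo)
open import Data.List.Relation.Binary.Permutation.Propositional using (_↭_; ↭-refl; ↭-sym; ↭-trans; prep; swap)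
open import Data.List.Relation.Binary.Permutation.Propositional.Properties using (∈-resp-↭; All-resp-↭)
import Data.List.Relation.Binary.Sublist.Propositional as Sublist
import Data.List.Relation.Binary.Sublist.Propositional.Properties as Sublistₚ
open import Data.List.Relation.Binary.Subset.Propositional using (_⊆_)
open import Data.List.Relation.Unary.All as All using (All; []; _∷_)
import Data.List.Relation.Unary.All.Properties as Allₚ
open import Data.List.Relation.Unary.AllPairs using ([]; _∷_)
open import Data.List.Relation.Unary.Any as Any using (here; there)
open import Data.List.Relation.Unary.Unique.DecPropositional.Properties using (deduplicate-!)
open import Data.List.Relation.Unary.Unique.Propositional using (Unique)
import Data.List.Relation.Unary.Unique.Propositional.Properties as Uniqueₚ
open import Data.Nat.Base using (ℕ; zero; suc; _+_; _≤_; _<_; _⊔_; z≤n; s≤s; _≤′_; ≤′-refl; ≤′-step)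
open import Data.Nat.ListAction using (sum)
open import Data.Nat.Properties
open import Data.Product.Base using (_×_; _,_; proj₁; proj₂; ∃; ∃-syntax)
open import Function.Base using (_∘_)
open import Function.Bundles using (_↔_; Inverse)
open import Level using (0ℓ)
open import Relation.Binary.Construct.Add.Supremum.Strict _<_ using (_<⁺_; [_])
open import Relation.Binary.PropositionalEquality using (_≡_; refl; sym; trans; cong; subst)
open import Relation.Nullary.Construct.Add.Supremum using ([_])
open import Relation.Nullary.Decidable using (Dec; yes; no; does)
open import Relation.Nullary.Negation using (¬_; contradiction)
open import Relation.Unary using (Pred; Decidable; _∩_)

-- The diagonal order.

position-next : ∀ n i → position (proj₁ (next (n , i))) (proj₂ (next (n , i))) ≡ suc (position n i)
position-next (suc n) i
  rewrite +-suc n i | +-suc (triangle (n + i) + suc (n + i)) i = refl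
position-next zero i
  rewrite +-identityʳ i | +-identityʳ (triangle i + suc i) = +-suc (triangle i) i

position-pair : ∀ l → position (proj₁ (pair l)) (proj₂ (pair l)) ≡ l
position-pair zero    = refl
position-pair (suc l) = trans (position-next (proj₁ (pair l)) (proj₂ (pair l))) (cong suc (position-pair l))

-- Sums, sublists and prefixed sequences.

sum-map-filter-≤ : {A : Set} {P : Pred A 0ℓ} (P? : Decidable P) (f : A → ℕ) (xs : List A) →
  sum (map f (filter P? xs)) ≤ sum (map f xs)
sum-map-filter-≤ P? f []       = z≤n
sum-map-filter-≤ P? f (x ∷ xs) with does (P? x)
... | true  = +-monoʳ-≤ (f x) (sum-map-filter-≤ P? f xs)
... | false = m≤n⇒m≤o+n (f x) (sum-map-filter-≤ P? f xs)

-- A list has only finitely many sublists. This later gives one bound on candidates that serves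
-- every choice of `D`.
bound-on-sublists : {A : Set} (f : List A → ℕ) (xs : List A) →
  ∃[ N ] (∀ {ys} → ys Sublist.⊆ xs → f ys ≤ N)
bound-on-sublists f []       = f [] , λ { Sublist.[] → ≤-refl }
bound-on-sublists f (x ∷ xs) with bound-on-sublists f xs | bound-on-sublists (f ∘ (x ∷_)) xs
... | M , f≤M | N , f≤N = M ⊔ N , λ
  { (_ Sublist.∷ʳ ys⊆xs)   → ≤-trans (f≤M ys⊆xs) (m≤m⊔n M N)
  ; (refl Sublist.∷ ys⊆xs) → ≤-trans (f≤N ys⊆xs) (m≤n⊔m M N) }

prepend : {A : Set} → List A → (ℕ → A) → ℕ → A
prepend []       y t       = y t
prepend (x ∷ xs) y zero    = x
prepend (x ∷ xs) y (suc t) = prepend xs y t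

applyUpTo-prepend : {A : Set} (xs : List A) (y : ℕ → A) → applyUpTo (prepend xs y) (length xs) ≡ xs
applyUpTo-prepend []       y = refl
applyUpTo-prepend (x ∷ xs) y = cong (x ∷_) (applyUpTo-prepend xs y)

prepend-shift : {A : Set} (xs : List A) (y : ℕ → A) → ∀ k → prepend xs y (length xs + k) ≡ y k
prepend-shift []       y k = refl
prepend-shift (x ∷ xs) y k = prepend-shift xs y k

sum-prepend-≤ : {A : Set} (f : A → ℕ) (xs : List A) (y : ℕ → A) → (∀ k → f (y k) ≡ 0) →
  ∀ N → sum (applyUpTo (f ∘ prepend xs y) N) ≤ sum (map f xs)
sum-prepend-≤ f xs       y fy≡0 zero    = z≤n
sum-prepend-≤ f (x ∷ xs) y fy≡0 (suc N) = +-monoʳ-≤ (f x) (sum-prepend-≤ f xs y fy≡0 N)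
sum-prepend-≤ f []       y fy≡0 (suc N) rewrite fy≡0 0 = sum-prepend-≤ f [] (y ∘ suc) (fy≡0 ∘ suc) N

-- Classical tools: pigeonhole, extremal numbers, deduplication.

module Classical (em : ExcludedMiddle 0ℓ) where

  length-⊆ : {A : Set} {xs ys : List A} → Unique xs → xs ⊆ ys → length xs ≤ length ys
  length-⊆ []                              _     = z≤n
  length-⊆ {xs = x ∷ xs} {ys} (x∉xs ∷ xs!) xs⊆ys =
    ≤-<-trans
      (length-⊆ xs! λ v∈xs → ∈-filter⁺ ≢x? (xs⊆ys (there v∈xs)) (All.lookup x∉xs v∈xs))
      (filter-notAll ≢x? ys (Any.map (λ x≡v x≢v → x≢v x≡v) (xs⊆ys (here refl))))
    where
    ≢x? : Decidable (λ v → ¬ x ≡ v)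
    ≢x? v = em

  least : (P : Pred ℕ 0ℓ) → ∀ k → P k → ∃[ m ] P m × (∀ j → P j → m ≤ j)
  least P zero    p0 = 0 , p0 , λ _ _ → z≤n
  least P (suc k) pk with em {P 0}
  ... | yes p0 = 0 , p0 , λ _ _ → z≤n
  ... | no ¬p0 with least (P ∘ suc) k pk
  ...   | m , pm , m≤ = suc m , pm , λ { zero p0 → contradiction p0 ¬p0 ; (suc j) pj → s≤s (m≤ j pj) }

  greatest : (P : Pred ℕ 0ℓ) → ∀ N → (∀ j → P j → j ≤ N) → ∃ P → ∃[ m ] P m × (∀ j → P j → j ≤ m)
  greatest P zero    P≤N (k , pk) = 0 , subst P (n≤0⇒n≡0 (P≤N k pk)) pk , P≤N
  greatest P (suc N) P≤N ∃P with em {P (suc N)}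
  ... | yes pN = suc N , pN , P≤N
  ... | no ¬pN = greatest P N (λ j pj → ≤-pred (≤∧≢⇒< (P≤N j pj) λ { refl → ¬pN pj })) ∃P

  escape : {A : Set} {P : Pred A 0ℓ} → Infinite P → (xs : List A) → ∃[ u ] P u × u ∉ xs
  escape {P = P} inf xs with em {∃[ u ] P u × u ∉ xs}
  ... | yes found = found
  ... | no ¬found = contradiction (xs , covers) inf
    where
    covers : ∀ u → P u → u ∈ xs
    covers u pu with em {u ∈ xs}
    ... | yes u∈xs = u∈xs
    ... | no  u∉xs = contradiction (u , pu , u∉xs) ¬found

  _≟ᶜ_ : {A : Set} (u v : A) → Dec (u ≡ v)
  u ≟ᶜ v = em

  module _ {A : Set} where

    sum-map-deduplicate-≤ : (f : A → ℕ) (xs : List A) →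
      sum (map f (deduplicate _≟ᶜ_ xs)) ≤ sum (map f xs)
    sum-map-deduplicate-≤ f []       = z≤n
    sum-map-deduplicate-≤ f (x ∷ xs) =
      +-monoʳ-≤ (f x) (≤-trans (sum-map-filter-≤ _ f (deduplicate _≟ᶜ_ xs)) (sum-map-deduplicate-≤ f xs))

    deduplicate-unique : {xs : List A} → Unique xs → deduplicate _≟ᶜ_ xs ≡ xs
    deduplicate-unique []           = refl
    deduplicate-unique (x∉xs ∷ xs!) rewrite deduplicate-unique xs! = cong (_ ∷_) (filter-all _ x∉xs)

  -- Noise, candidates and `mchk`.

  module Generation {U : Set} (C : ℕ → Language U) where

    open NoisyGeneration em C

    𝟙-false : {P : Set} → ¬ P → 𝟙 P ≡ 0
    𝟙-false {P} ¬p with em {P}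
    ... | yes p = contradiction p ¬p
    ... | no  _ = refl

    noise : Language U → List U → ℕ
    noise L T = sum (map (λ u → 𝟙 (¬ string L u)) T)

    string? : (L : Language U) → Decidable (string L)
    string? L u = em

    length-≤-noise : ∀ L T → length T ≤ noise L T + length (filter (string? L) T)
    length-≤-noise L []      = z≤n
    length-≤-noise L (u ∷ T) with em {string L u} | em {¬ string L u}
    ... | yes u∈L | yes u∉L = contradiction u∈L u∉L
    ... | no u∉L  | no ¬u∉L = contradiction u∉L ¬u∉L
    ... | no _    | yes _   = s≤s (length-≤-noise L T)
    ... | yes _   | no _    =
      ≤-trans (s≤s (length-≤-noise L T)) (≤-reflexive (sym (+-suc (noise L T) _)))

    AllContained : List U → List Pair → Set
    AllContained T D = All (λ (a , b) → Contained a T (C b)) D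

    -- Each member `(a , b)` of `D` discards at most `a` strings of `T`; whatever survives lies in
    -- the intersection and so in `xs`. The predicate `P` accumulates the languages already filtered
    -- by.
    length-≤-intersection : ∀ D {P : Pred U 0ℓ} {T xs} → Unique T → All P T → AllContained T D →
      (∀ u → P u → Intersection D u → u ∈ xs) → length T ≤ length xs + sum (map proj₁ D)
    length-≤-intersection [] T! PT [] covers =
      m≤n⇒m≤n+o 0 (length-⊆ T! λ u∈T → covers _ (All.lookup PT u∈T) [])
    length-≤-intersection ((a , b) ∷ D) {P} {T} {xs} T! PT (T⊆b ∷ T⊆D) covers = begin
      length T                                 ≤⟨ length-≤-noise (C b) T ⟩
      noise (C b) T + length T′                ≤⟨ +-mono-≤ T⊆b bound ⟩
      a + (length xs + sum (map proj₁ D))      ≡⟨ +-comm a _ ⟩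
      length xs + sum (map proj₁ D) + a        ≡⟨ +-assoc (length xs) _ a ⟩
      length xs + (sum (map proj₁ D) + a)      ≡⟨ cong (length xs +_) (+-comm _ a) ⟩
      length xs + (a + sum (map proj₁ D))      ∎
      where
      open ≤-Reasoning
      T′ = filter (string? (C b)) T
      bound : length T′ ≤ length xs + sum (map proj₁ D)
      bound = length-≤-intersection D {P ∩ string (C b)}
        (Uniqueₚ.filter⁺ _ T!)
        (All.zip (Allₚ.filter⁺ _ PT , Allₚ.all-filter _ T))
        (All.map (≤-trans (sum-map-filter-≤ _ _ T)) T⊆D)
        (λ u (pu , u∈b) u∈D → covers u pu (u∈b ∷ u∈D))

    -- Here `D` may list its members in any order and with repetitions, so the bound does not depend
    -- on how the entries are arranged.
    Bounds : Pair → List Pair → ℕ → Set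
    Bounds e es m = ∀ {T D} → Unique T → D ⊆ e ∷ es → e ∈ D → AllContained T D →
      Finite (Intersection D) → length T ≤ m

    -- Filtering `e ∷ es` by membership in `D` gives a genuine sublist with the same members, hence
    -- the same containments and intersection.
    candidate : ∀ {e es T D} → Unique T → D ⊆ e ∷ es → e ∈ D → AllContained T D →
      Finite (Intersection D) → Candidate e es T
    candidate {e} {es} {T} {D} T! D⊆ e∈D T⊆D (xs , covers) =
        T!
      , filter ∈D? (e ∷ es)
      , Sublistₚ.filter-⊆ ∈D? (e ∷ es)
      , ∈-filter⁺ ∈D? (here refl) e∈D
      , All.tabulate (λ f∈ → All.lookup T⊆D (proj₂ (∈-filter⁻ ∈D? {xs = e ∷ es} f∈)))
      , xs , λ u u∈ → covers u (All.tabulate λ f∈D → All.lookup u∈ (∈-filter⁺ ∈D? (D⊆ f∈D) f∈D))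
      where
      ∈D? : Decidable (_∈ D)
      ∈D? f = em

    candidates-bounded : ∀ e es → ∃[ N ] (∀ T → Candidate e es T → length T ≤ N)
    candidates-bounded e es = N , bounded
      where
      -- 0 is a junk value where the intersection is infinite.
      size : ∀ {D} → Dec (Finite (Intersection D)) → ℕ
      size {D} (yes (xs , _)) = length xs + sum (map proj₁ D)
      size     (no _)         = 0

      N = proj₁ (bound-on-sublists (λ D → size {D} em) (e ∷ es))

      length-≤-size : ∀ {D T} → Unique T → AllContained T D → Finite (Intersection D) →
        (fin? : Dec (Finite (Intersection D))) → length T ≤ size fin?
      length-≤-size {D} T! T⊆D _   (yes (xs , covers)) =
        length-≤-intersection D {λ u → u ≡ u} T! (All.universal (λ _ → refl) _) T⊆D (λ u _ → covers u)
      length-≤-size     _  _   fin (no inf)            = contradiction fin inf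

      bounded : ∀ T → Candidate e es T → length T ≤ N
      bounded T (T! , D , D⊆ , _ , T⊆D , fin) =
        ≤-trans (length-≤-size T! T⊆D fin em) (proj₂ (bound-on-sublists (λ D → size {D} em) (e ∷ es)) D⊆)

    largestSize : ∀ {e es T} → Candidate e es T → ∃ (LargestSize e es)
    largestSize {e} {es} {T} cand
      with N , T≤N ← candidates-bounded e es
      with m , attained , ≤m ← greatest (λ m → ∃[ T ] Candidate e es T × length T ≡ m) N
                                 (λ { _ (T , c , refl) → T≤N T c }) (_ , T , cand , refl)
      = m , attained , λ T c → ≤m _ (T , c , refl)

    mchk-bounds : ∀ e es → Bounds e es (mchk e es)
    mchk-bounds e es T! D⊆ e∈D T⊆D fin with em {∃ (LargestSize e es)}
    ... | yes (_ , _ , ≤m) = ≤m _ (candidate T! D⊆ e∈D T⊆D fin)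
    ... | no ¬largest      = contradiction (largestSize (candidate T! D⊆ e∈D T⊆D fin)) ¬largest

    mchk-attained : ∀ e es → 0 < mchk e es → LargestSize e es (mchk e es)
    mchk-attained e es 0<m with em {∃ (LargestSize e es)}
    ... | yes (_ , largest) = largest
    ... | no  _             = contradiction 0<m λ ()

    -- A `D` available among fewer entries remains available among more.
    mchk-mono : ∀ e {f es} → mchk e es ≤ mchk e (f ∷ es)
    mchk-mono e {f} {es} with 0 <? mchk e es
    ... | no 0≮m = ≤-trans (≮⇒≥ 0≮m) z≤n
    ... | yes 0<m with (T , (T! , D , D⊆ , e∈D , T⊆D , fin) , |T|≡m) , _ ← mchk-attained e es 0<m =
      subst (_≤ mchk e (f ∷ es)) |T|≡m
        (mchk-bounds e (f ∷ es) T! (widen ∘ Sublist.lookup D⊆) e∈D T⊆D fin)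
      where
      widen : e ∷ es ⊆ e ∷ f ∷ es
      widen (here refl) = here refl
      widen (there p)   = there (there p)

    -- The invariant of the insertion procedure.

    data Valid : List Entry → Set where
      []   : Valid []
      cons : ∀ {e m es} → Bounds e (map proj₁ es) m → All (λ (_ , k) → k ≤ m) es → Valid es →
        Valid ((e , m) ∷ es)

    insert-↭ : ∀ e es → proj₂ (insert e es) ↭ (e , proj₁ (insert e es)) ∷ es
    insert-↭ e []             = ↭-refl
    insert-↭ e ((f , m) ∷ es) with m <? mchk e (f ∷ map proj₁ es)
    ... | yes _ = ↭-refl
    ... | no  _ = ↭-trans (prep _ (insert-↭ e es)) (swap _ _ ↭-refl)

    -- Moving forward leaves fewer entries to choose `D` from. Hence a failed test at `f` caps the
    -- final value of `e` by that of `f`, which keeps the list sorted.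
    insert-≤ : ∀ e es → proj₁ (insert e es) ≤ mchk e (map proj₁ es)
    insert-≤ e []             = ≤-refl
    insert-≤ e ((f , m) ∷ es) with m <? mchk e (f ∷ map proj₁ es)
    ... | yes _ = ≤-refl
    ... | no  _ = ≤-trans (insert-≤ e es) (mchk-mono e)

    -- When e moves past f, a D containing both was already examined while e was
    -- still behind f, so the value of f remains a bound.
    insert-valid : ∀ e {es} → Valid es → Valid (proj₂ (insert e es))
    insert-valid e []                                       = cons (mchk-bounds e []) [] []
    insert-valid e v@(cons {f} {m} {es} f-bound es≤m es-valid) with m <? mchk e (f ∷ map proj₁ es)
    ... | yes m<c = cons (mchk-bounds e _) (<⇒≤ m<c ∷ All.map (λ k≤m → ≤-trans k≤m (<⇒≤ m<c)) es≤m) v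
    ... | no  m≮c = cons bound
                      (All-resp-↭ (↭-sym (insert-↭ e es))
                        (≤-trans (insert-≤ e es) (≤-trans (mchk-mono e) (≮⇒≥ m≮c)) ∷ es≤m))
                      (insert-valid e es-valid)
      where
      entries : ∀ {g} → g ∈ f ∷ map proj₁ (proj₂ (insert e es)) → g ∈ e ∷ f ∷ map proj₁ es
      entries (here g≡f) = there (here g≡f)
      entries (there g∈) with (_ , p∈ , refl) ← ∈-map⁻ proj₁ g∈ with ∈-resp-↭ (insert-↭ e es) p∈
      ... | here refl = here refl
      ... | there p∈es = there (there (∈-map⁺ proj₁ p∈es))

      bound : Bounds f (map proj₁ (proj₂ (insert e es))) m
      bound {D = D} T! D⊆ f∈D T⊆D fin with em {e ∈ D}
      ... | yes e∈D = ≤-trans (mchk-bounds e _ T! (entries ∘ D⊆) e∈D T⊆D fin) (≮⇒≥ m≮c)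
      ... | no  e∉D = f-bound T! D⊆f∷es f∈D T⊆D fin
        where
        D⊆f∷es : D ⊆ f ∷ map proj₁ es
        D⊆f∷es g∈D with entries (D⊆ g∈D)
        ... | here refl = contradiction g∈D e∉D
        ... | there g∈  = g∈

    -- The list `fs` is what precedes `e` when it stops. The stopping test makes the value of the
    -- nearest entry strictly smaller, and sortedness extends this to the rest.
    insert-attained : ∀ e {es} → Valid es → 0 < proj₁ (insert e es) →
      ∃[ fs ] LargestSize e (map proj₁ fs) (proj₁ (insert e es))
            × All (λ p → p ∈ es × proj₂ p < proj₁ (insert e es)) fs
    insert-attained e []                                       0<m = [] , mchk-attained e [] 0<m , []
    insert-attained e (cons {f} {m} {es} _ es≤m es-valid) 0<m with m <? mchk e (f ∷ map proj₁ es)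
    ... | yes m<c = (f , m) ∷ es , mchk-attained e _ 0<m ,
                    (here refl , m<c) ∷ All.tabulate λ p∈es → there p∈es , ≤-<-trans (All.lookup es≤m p∈es) m<c
    ... | no  _   with fs , largest , fs< ← insert-attained e es-valid 0<m =
      fs , largest , All.map (λ (p∈es , p<) → there p∈es , p<) fs<

    procedure-valid : ∀ l → Valid (procedure l)
    procedure-valid zero    = []
    procedure-valid (suc l) = insert-valid (pair l) (procedure-valid l)

    procedure-mono : ∀ {k l} → k ≤′ l → procedure k ⊆ procedure l
    procedure-mono ≤′-refl                p∈ = p∈
    procedure-mono (≤′-step {n = l} k≤l) p∈ =
      ∈-resp-↭ (↭-sym (insert-↭ (pair l) (procedure l))) (there (procedure-mono k≤l p∈))

    ∈-procedure : ∀ n i {l} → position n i < l → ((n , i) , m⋆ n i) ∈ procedure l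
    ∈-procedure n i pos<l = procedure-mono (≤⇒≤′ pos<l)
      (∈-resp-↭ (↭-sym (insert-↭ (pair (position n i)) (procedure (position n i))))
        (here (cong (λ e → e , proj₁ (insert e (procedure (position n i)))) (sym (pair-position n i)))))

    -- Each pair is appended in exactly one round, and later insertions never alter a value already
    -- set.
    procedure-value : ∀ l {n i k} → ((n , i) , k) ∈ procedure l → k ≡ m⋆ n i
    procedure-value (suc l) p∈ with ∈-resp-↭ (insert-↭ (pair l) (procedure l)) p∈
    ... | here refl  = cong (λ p → proj₁ (insert (pair l) (procedure p))) (sym (position-pair l))
    ... | there p∈′ = procedure-value l p∈′

    -- Infinite intersections and the generating algorithm.

    eventually-listed : ∀ D → ∃[ l ] (∀ {n i} → (n , i) ∈ D → position n i < l)
    eventually-listed []            = 0 , λ ()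
    eventually-listed ((n , i) ∷ D) with l , D<l ← eventually-listed D = suc (position n i) ⊔ l , λ
      { (here refl) → m≤m⊔n (suc (position n i)) l
      ; (there p∈D) → ≤-trans (D<l p∈D) (m≤n⊔m (suc (position n i)) l) }

    -- The last member of D in the list has a value at least |T|.
    valid⇒value-≥ : ∀ {es T D d} → Valid es → Unique T → AllContained T D → Finite (Intersection D) →
      d ∈ D → (∀ {e} → e ∈ D → ∃[ k ] (e , k) ∈ es × k < length T) → ⊥
    valid⇒value-≥ [] T! T⊆D fin d∈D listed with () ← proj₁ (proj₂ (listed d∈D))
    valid⇒value-≥ {T = T} {D} (cons {f} {m} {es} bound _ es-valid) T! T⊆D fin d∈D listed
      -- The test includes the value because `Valid` alone does not exclude that `f` recurs further
      -- down with a smaller one.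
      with em {f ∈ D × m < length T}
    ... | yes (f∈D , m<T) = <⇒≱ m<T (bound T! D⊆ f∈D T⊆D fin)
      where
      D⊆ : D ⊆ f ∷ map proj₁ es
      D⊆ e∈D = ∈-map⁺ proj₁ (proj₁ (proj₂ (listed e∈D)))
    ... | no ¬head = valid⇒value-≥ es-valid T! T⊆D fin d∈D listed-later
      where
      listed-later : ∀ {e} → e ∈ D → ∃[ k ] (e , k) ∈ es × k < length T
      listed-later e∈D with listed e∈D
      ... | _ , here refl , k<T = contradiction (e∈D , k<T) ¬head
      ... | k , there p∈  , k<T = k , p∈ , k<T

    Compatible : List U → Pred Pair 0ℓ
    Compatible T (n , j) = m⋆ n j < length T × Contained n T (C j)

    compatible? : ∀ T → Decidable (Compatible T)
    compatible? T p = em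

    intersection-infinite : ∀ {T} D → Unique T → All (Compatible T) D → Infinite (Intersection D)
    -- The empty intersection is all of `U`, which is infinite because it contains `C 0`.
    intersection-infinite []            T! _  (xs , covers) = infinite (C 0) (xs , λ u _ → covers u [])
    intersection-infinite {T} D@(_ ∷ _) T! D⊑ fin           with l , D<l ← eventually-listed D =
      valid⇒value-≥ (procedure-valid l) T! (All.map proj₂ D⊑) fin (here refl)
        λ e∈D → _ , ∈-procedure _ _ (D<l e∈D) , proj₁ (All.lookup D⊑ e∈D)

    GoodOutput : List U → Pred U 0ℓ
    GoodOutput T u = (∀ n j → Compatible T (n , j) → string (C j) u) × u ∉ T

    -- By the finiteness hypothesis all compatible pairs occur in one finite list, so their
    -- languages have an infinite intersection, which leaves `T`.
    goodOutput : (∀ t → Finite (λ ((n , j) : ℕ × ℕ) → m⋆ n j + 1 ≤ t)) →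
      ∀ {T} → Unique T → ∃ (GoodOutput T)
    goodOutput fin {T} T!
      with F , covers ← fin (length T)
      with u , u∈D , u∉T ← escape (intersection-infinite (filter (compatible? T) F) T! (Allₚ.all-filter (compatible? T) F)) T
      = u , in-all , u∉T
      where
      in-all : ∀ n j → Compatible T (n , j) → string (C j) u
      in-all n j c = All.lookup u∈D
        (∈-filter⁺ (compatible? T) (covers (n , j) (subst (_≤ length T) (+-comm 1 (m⋆ n j)) (proj₁ c))) c)

    generator : U → Algorithm U
    generator u₀ xs with em {∃ (GoodOutput (deduplicate _≟ᶜ_ xs))}
    ... | yes (u , _) = u
    -- A default value, never reached under the finiteness hypothesis.
    ... | no  _       = u₀

    generator-good : ∀ u₀ xs → ∃ (GoodOutput (deduplicate _≟ᶜ_ xs)) →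
      GoodOutput (deduplicate _≟ᶜ_ xs) (generator u₀ xs)
    generator-good u₀ xs found with em {∃ (GoodOutput (deduplicate _≟ᶜ_ xs))}
    ... | yes (_ , good) = good
    ... | no ¬found      = contradiction found ¬found

    -- Since t ≥ 1, an algorithm with generation time 1 also has generation time 0,
    -- so m⋆ + 1 is not the least possible time when m⋆ = 0.
    time : ℕ → ℕ
    time zero    = zero
    time (suc m) = suc (suc m)

    time-≤ : ∀ m → time m ≤ suc m
    time-≤ zero    = z≤n
    time-≤ (suc m) = ≤-refl

    time-sound : ∀ {m s} → 1 ≤ s → time m ≤ s → m < s
    time-sound {zero}  1≤s _   = 1≤s
    time-sound {suc m} _   t≤s = t≤s

    time-tight : ∀ {m k} → k < time m → 0 < m × k ≤ m
    time-tight {suc m} (s≤s k≤m) = s≤s z≤n , k≤m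

    generator-generates : (∀ t → Finite (λ ((n , j) : ℕ × ℕ) → m⋆ n j + 1 ≤ t)) →
      ∀ u₀ → GeneratesWithTimes (generator u₀) (λ n i → time (m⋆ n i))
    generator-generates fin u₀ n i x (_ , noise≤n) t@(suc _) 1≤t τ≤ =
        -- As `t` is a successor, `S x t` is visibly nonempty, so `s≤s z≤n` proves
        -- `1 ≤ length (S x t)`.
        proj₁ good n i (time-sound (s≤s z≤n) τ≤ , contained) , proj₂ good
      where
      good : GoodOutput (S x t) (generator u₀ (input x t))
      good = generator-good u₀ (input x t) (goodOutput fin (deduplicate-! _≟ᶜ_ (input x t)))
      contained : Contained n (S x t) (C i)
      contained = ≤-trans (sum-map-deduplicate-≤ _ (input x t))
        (≤-trans (≤-reflexive (cong sum (map-applyUpTo x _ t))) (noise≤n t))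

    generatesAfter-mono : ∀ G {n i k m} → k ≤ m → GeneratesAfter G n i k → GeneratesAfter G n i m
    generatesAfter-mono G k≤m gen x enum t 1≤t m≤ = gen x enum t 1≤t (≤-trans k≤m m≤)

    𝟙-¬string : ∀ (L : Language U) {u} → string L u → 𝟙 (¬ string L u) ≡ 0
    𝟙-¬string L u∈L = 𝟙-false λ u∉L → u∉L u∈L

    -- Adversarial enumerations and Pareto optimality.

    module _ (ℕ↔U : ℕ ↔ U) where
      open Inverse ℕ↔U using (to; from; strictlyInverseˡ)

      -- Run through `U` and replace each string outside `L` by a fixed member `u₀`.
      surjection : (L : Language U) → ∃[ y ] (∀ k → string L (y k)) × (∀ u → string L u → ∃[ k ] y k ≡ u)
      surjection L with u₀ , u₀∈L , _ ← escape (infinite L) [] = (λ k → y (em {string L (to k)})) , sound , complete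
        where
        y : ∀ {k} → Dec (string L (to k)) → U
        y {k} (yes _) = to k
        y     (no _)  = u₀
        sound : ∀ k → string L (y (em {string L (to k)}))
        sound k with em {string L (to k)}
        ... | yes k∈L = k∈L
        ... | no  _   = u₀∈L
        complete : ∀ u → string L u → ∃[ k ] y (em {string L (to k)}) ≡ u
        complete u u∈L = from u , eq
          where
          eq : y (em {string L (to (from u))}) ≡ u
          eq with em {string L (to (from u))}
          ... | yes _  = strictlyInverseˡ u
          ... | no  u∉L = contradiction (subst (string L) (sym (strictlyInverseˡ u)) u∈L) u∉L

      -- The adversary presents `T` and then only strings of `C b`, so all noise comes from `T`. At
      -- time `length T` the input is exactly `T`, and so is the set of strings seen.
      output-after : ∀ {G a b k T} → GeneratesAfter G a b k → Unique T → Contained a T (C b) →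
        1 ≤ length T → k ≤ length T → string (C b) (G T) × G T ∉ T
      output-after {G} {a} {b} {k} {T} gen T! T⊆b 1≤T k≤T
        with y , y∈L , y-onto ← surjection (C b)
        = subst (λ xs → string (C b) (G xs)) input≡T (proj₁ out)
        , subst (G T ∉_) S≡T (subst (λ xs → G xs ∉ S x (length T)) input≡T (proj₂ out))
        where
        x = prepend T y
        input≡T : input x (length T) ≡ T
        input≡T = applyUpTo-prepend T y
        S≡T : S x (length T) ≡ T
        S≡T = trans (cong (deduplicate _≟ᶜ_) input≡T) (deduplicate-unique T!)
        enum : Enumeration (C b) a x
        enum = (λ u u∈b → let j , yj≡u = y-onto u u∈b in length T + j , trans (prepend-shift T y j) yj≡u)
             , (λ N → ≤-trans (sum-prepend-≤ _ T y (λ j → 𝟙-¬string (C b) (y∈L j)) N) T⊆b)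
        out : string (C b) (G (input x (length T))) × G (input x (length T)) ∉ S x (length T)
        out = gen x enum (length T) 1≤T (subst (k ≤_) (sym (cong length S≡T)) k≤T)

      pareto-optimal : ParetoOptimal (λ n i → time (m⋆ n i))
      pareto-optimal G (σ , gen) n i ([ k ] , (gen-k , _) , [ k<τ ])
        with em {∃[ n′ ] ∃[ j ] ¬ (n′ , j) ≡ (n , i) × (∃[ m ] GenerationTime G n′ j m × [ time (m⋆ n′ j) ] <⁺ m)}
      ... | yes slower = slower
      ... | no ¬slower
        -- Beating `time` forces a positive value, so a candidate `T` attains it, and `k` is at most
        -- `length T`.
        with 0<m , k≤m ← time-tight k<τ
        with fs , ((T , (T! , D , D⊆ , e∈D , T⊆D , fin) , |T|≡m) , largest) , fs<
               ← insert-attained (n , i) (procedure-valid (position n i)) 0<m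
        = contradiction
            (largest (G T ∷ T)
              -- The new string `G T` lies in the language of every member of `D`, so it adds no
              -- noise, and the same `D` witnesses a candidate of size one above the maximum.
              ( Allₚ.¬Any⇒All¬ T (proj₂ (output e∈D)) ∷ T!
              , D , D⊆ , e∈D
              , All.tabulate (λ {(a , b)} d∈D → subst (λ z → z + noise (C b) T ≤ a)
                                (sym (𝟙-¬string (C b) (proj₁ (output d∈D)))) (All.lookup T⊆D d∈D))
              , fin))
            (<⇒≱ (≤-reflexive (cong suc (sym |T|≡m))))
        where
        not-slower : ∀ n′ j → ¬ (n′ , j) ≡ (n , i) → GeneratesAfter G n′ j (time (m⋆ n′ j))
        -- Being slower refers to the least generation time, which exists because `σ n′ j` is one.
        not-slower n′ j ≢e with m , gen-m , m-least ← least (GeneratesAfter G n′ j) (σ n′ j) (gen n′ j)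
          with time (m⋆ n′ j) <? m
        ... | yes τ<m = contradiction (n′ , j , ≢e , [ m ] , (gen-m , m-least) , [ τ<m ]) ¬slower
        ... | no  τ≮m = generatesAfter-mono G (≮⇒≥ τ≮m) gen-m

        generates : ∀ {a b} → (a , b) ∈ D → GeneratesAfter G a b (length T)
        generates {a} {b} d∈D with em {(a , b) ≡ (n , i)}
        ... | yes refl = generatesAfter-mono G (subst (k ≤_) (sym |T|≡m) k≤m) gen-k
        ... | no d≢e with Sublist.lookup D⊆ d∈D
        ...   | here d≡e = contradiction d≡e d≢e
        ...   | there d∈fs with (_ , p∈fs , refl) ← ∈-map⁻ proj₁ d∈fs
                           with p∈ , p<m ← All.lookup fs< p∈fs
                           rewrite procedure-value (position n i) p∈ =
          -- Any other member of `D` has value below `length T`, so its `time`, at most the value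
          -- plus one, has been reached.
          generatesAfter-mono G (≤-trans (time-≤ _) (subst (m⋆ a b <_) (sym |T|≡m) p<m)) (not-slower a b d≢e)

        output : ∀ {a b} → (a , b) ∈ D → string (C b) (G T) × G T ∉ T
        output d∈D = output-after (generates d∈D) T! (All.lookup T⊆D d∈D)
          (subst (1 ≤_) (sym |T|≡m) 0<m) ≤-refl

mainTheorem7 : (em : ExcludedMiddle 0ℓ) (U : Set) → ℕ ↔ U → (C : ℕ → Language U) →
    let open NoisyGeneration em C in
    (∀ t → Finite (λ ((n , j) : ℕ × ℕ) → m⋆ n j + 1 ≤ t)) →
    ∃[ G ] ∃[ τ ] (GeneratesWithTimes G τ × ParetoOptimal τ)
mainTheorem7 em U ℕ↔U C fin =
    generator (Inverse.to ℕ↔U 0)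
  , (λ n i → time (m⋆ n i))
  , generator-generates fin _
  , pareto-optimal ℕ↔U
  where
  open NoisyGeneration em C
  open Classical em
  open Generation C
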